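{- There is no winning team consisting of exactly $4$ polyominoes. Moreover, the five sets $\mathcal{N}_{4,1}=\{L_2\}$, $\mathcal{N}_{4,2}=\{S_3,Z_2\}$, $\mathcal{N}_{4,3}=\{S_3,C_2\}$, $\mathcal{N}_{4,4}=\{S_4,L_3,C_2,Z_2\}$ and $\mathcal{N}_{4,5}=\{S_4,T_2,C_2,Z_2\}$ form a characterizing collection of losers for size $4$ teams; that is, each $\mathcal{N}_{4,i}$ is a losing team, and for every team $\mathcal{F}$ with exactly $4$ elements there is an $i\in\{1,\dots,5\}$ such that $\mathcal{N}_{4,i}\preceq\mathcal{F}$.
   Context: Board and polyominoes. The cells are the translates of the unit square $[0,1]\times[0,1]$ by vectors of $\mathbf{Z}^2$; identify a cell with the vector in $\mathbf{Z}^2$. Two cells are adjacent if they share an edge. A polyomino is a nonempty (finite or infinite) set of cells that is connected through adjacent cells, considered up to congruence (translations, rotations, reflections of the board). Game. Two players, maker (moving first) and breaker, alternately mark previously unmarked cells of the infinite board: in each turn the maker marks 1 cell and the breaker marks 2 cells. For a set $\mathcal{S}$ of finite polyominoes, the maker wins if after finitely many moves he has marked all the cells of a set congruent to some element of $\mathcal{S}$; the breaker wins if she prevents this. $\mathcal{S}$ is a winner (winning) if the maker has a winning strategy. Ancestors. $P\sqsubseteq Q$ ($P$ is an ancestor of $Q$) means that some congruent copy of $P$ is a subset of $Q$. A team is a set of polyominoes no element of which is an ancestor of another element; its size is its number of elements. Unbounded sets. A set of polyominoes is unbounded if it contains an infinite polyomino. If $\mathcal{T}$ is unbounded and $F_T$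 is a finite ancestor of $T$ for each $T\in\mathcal{T}$, then $\{F_T\mid T\in\mathcal{T}\}$ is a bounded restriction of $\mathcal{T}$. An unbounded set is a winner if each of its bounded restrictions is a winner. A set that is not a winner is a loser (losing). Simpler. $\mathcal{S}\preceq\mathcal{T}$ means that for all $Q\in\mathcal{T}$ there is $P\in\mathcal{S}$ with $P\sqsubseteq Q$. Particular polyominoes (up to congruence): $S_n=\{(0,0),\dots,(n-1,0)\}$; $L_n=S_n\cup\{(0,1)\}$; $T_2=\{(0,0),(1,0),(2,0),(1,1)\}$; $C_2=\{(0,0),(1,0),(0,1),(1,1)\}$; $Z_2=\{(0,0),(1,0),(0,1),(1,-1)\}$. -}

module Defs where

open import Data.Bool.Base using (Bool; true; false)
open import Data.Fin.Base using (Fin; zero; suc)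
open import Data.Integer.Base as ℤ using (ℤ; +_; -[1+_]; 0ℤ; ∣_∣)
import Data.Integer.Properties as ℤ
open import Data.List.Base using (List; []; _∷_; applyDownFrom; concatMap)
open import Data.List.Membership.Propositional using (_∈_; _∉_; find)
open import Data.List.Relation.Unary.Any using (Any; here; there)
open import Data.Nat.Base as ℕ using (ℕ; zero; suc; NonZero)
import Data.Nat.Properties as ℕ
open import Data.Product.Base using (∃; ∃-syntax; _×_; _,_; proj₁; proj₂)
open import Data.Sign.Base using (Sign)
open import Data.Vec.Functional as Vector using (Vector)
open import Level using (0ℓ)
open import Relation.Binary.Construct.Closure.ReflexiveTransitive using (Star; ε; _◅_; _◅◅_; gmap)
open import Relation.Binary.PropositionalEquality using (_≡_; _≢_; refl; trans; cong; cong₂)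
open import Relation.Nullary using (¬_)
open import Relation.Unary using (Pred)

------------------------------------------------------------------------
-- Board and polyominoes

Cell : Set
Cell = ℤ × ℤ

-- Unit squares share an edge iff their positions are at ℓ¹-distance 1.
Adjacent : Cell → Cell → Set
Adjacent (x , y) (x′ , y′) = ∣ x ℤ.- x′ ∣ ℕ.+ ∣ y ℤ.- y′ ∣ ≡ 1

AdjacentIn : Pred Cell 0ℓ → Cell → Cell → Set
AdjacentIn P a b = P a × P b × Adjacent a b

-- Membership is an arbitrary predicate, so infinite polyominoes are
-- included.  A polyomino here is a representative of its congruence
-- class; every notion below is invariant under congruence.
record Polyomino : Set₁ where
  field
    cells     : Pred Cell 0ℓ
    nonempty  : ∃ cells
    connected : ∀ {a b} → cells a → cells b → Star (AdjacentIn cells) a b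

open Polyomino public

Finite : Polyomino → Set
Finite P = ∃[ cs ] (∀ {c} → cells P c → c ∈ cs)

Infinite : Polyomino → Set
Infinite P = ¬ Finite P

-- The congruences of the board: one of the eight signed permutations of
-- the coordinates followed by a translation.
record Congruence : Set where
  field
    swapped     : Bool
    sign₁ sign₂ : Sign
    shift       : Cell

signed : Sign → ℤ → ℤ
signed Sign.+ x = x
signed Sign.- x = ℤ.- x

swapIf : Bool → Cell → Cell
swapIf false c       = c
swapIf true  (x , y) = y , x

_·_ : Congruence → Cell → Cell
g · c = let open Congruence g; (x , y) = swapIf swapped c in
  proj₁ shift ℤ.+ signed sign₁ x , proj₂ shift ℤ.+ signed sign₂ y

infix 8 _·_
infix 4 _⊑_ _⪯_

_⊑_ : Polyomino → Polyomino → Set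
P ⊑ Q = ∃[ g ] (∀ {c} → cells P c → cells Q (g · c))

------------------------------------------------------------------------
-- Sets of polyominoes, given as indexed families

-- Distinct indices carry incomparable, hence incongruent, members; so a
-- team indexed by Fin n has exactly n elements, and every n-element team
-- arises in this way.
IsTeam : {I : Set} → (I → Polyomino) → Set
IsTeam 𝒮 = ∀ {i j} → i ≢ j → ¬ (𝒮 i ⊑ 𝒮 j)

_⪯_ : {I J : Set} → (I → Polyomino) → (J → Polyomino) → Set
𝒮 ⪯ 𝒯 = ∀ j → ∃[ i ] 𝒮 i ⊑ 𝒯 j

Bounded : {I : Set} → (I → Polyomino) → Set
Bounded 𝒮 = ∀ i → Finite (𝒮 i)

Unbounded : {I : Set} → (I → Polyomino) → Set
Unbounded 𝒮 = ∃[ i ] Infinite (𝒮 i)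

IsBoundedRestriction : {I : Set} → (ℱ 𝒯 : I → Polyomino) → Set
IsBoundedRestriction ℱ 𝒯 = ∀ i → Finite (ℱ i) × ℱ i ⊑ 𝒯 i

------------------------------------------------------------------------
-- The game

-- The two cells marked by the breaker in one turn.
Reply : Set
Reply = Cell × Cell

-- The next cell of the maker as a function of the breaker's previous
-- turns, latest first.  The maker's own previous cells are determined by
-- the strategy.
Strategy : Set
Strategy = List Reply → Cell

-- The breaker's turns of a play.
Replies : Set
Replies = ℕ → Reply

module Play (σ : Strategy) (β : Replies) where

  -- Turns are numbered from 0; in each round the maker moves first.
  makerCell : ℕ → Cell
  makerCell n = σ (applyDownFrom β n)

  makerMarks : ℕ → List Cell
  makerMarks n = applyDownFrom makerCell n

  breakerMarks : ℕ → List Cell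
  breakerMarks n = concatMap (λ (a , b) → a ∷ b ∷ []) (applyDownFrom β n)

  MakerLegal : Set
  MakerLegal = ∀ n → makerCell n ∉ makerMarks n × makerCell n ∉ breakerMarks n

  FreeForBreaker : ℕ → Cell → Set
  FreeForBreaker n c = c ∉ makerMarks (suc n) × c ∉ breakerMarks n

  BreakerLegal : Set
  BreakerLegal = ∀ n → let (a , b) = β n in
    a ≢ b × FreeForBreaker n a × FreeForBreaker n b

  MakerHas : {I : Set} → (I → Polyomino) → ℕ → Set
  MakerHas 𝒮 n = ∃[ i ] ∃[ g ] (∀ {c} → cells (𝒮 i) c → g · c ∈ makerMarks n)

-- Play formally continues after the maker has won; the board is infinite,
-- so this restricts neither player.
IsWinning : {I : Set} → (I → Polyomino) → Strategy → Set
IsWinning 𝒮 σ = ∀ β → let open Play σ β in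
  BreakerLegal → MakerLegal × ∃ (MakerHas 𝒮)

MakerWins : {I : Set} → (I → Polyomino) → Set
MakerWins 𝒮 = ∃ (IsWinning 𝒮)

data Winner {I : Set} (𝒮 : I → Polyomino) : Set₁ where
  bounded   : Bounded 𝒮 → MakerWins 𝒮 → Winner 𝒮
  unbounded : Unbounded 𝒮 →
              (∀ ℱ → IsBoundedRestriction ℱ 𝒮 → MakerWins ℱ) →
              Winner 𝒮

Loser : {I : Set} → (I → Polyomino) → Set₁
Loser 𝒮 = ¬ Winner 𝒮

------------------------------------------------------------------------
-- Finite polyominoes from lists of cells

data Connected : List Cell → Set where
  [_] : ∀ c → Connected (c ∷ [])
  _∷_ : ∀ {c cs} → Any (Adjacent c) cs → Connected cs → Connected (c ∷ cs)

private
  adjacent-sym : ∀ {a b} → Adjacent a b → Adjacent b a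
  adjacent-sym {x , y} {x′ , y′} =
    trans (cong₂ ℕ._+_ (ℤ.∣i-j∣≡∣j-i∣ x′ x) (ℤ.∣i-j∣≡∣j-i∣ y′ y))

  adjacentIn-sym : ∀ {P a b} → AdjacentIn P a b → AdjacentIn P b a
  adjacentIn-sym {a = a} {b} (p , q , r) = q , p , adjacent-sym {a} {b} r

  weaken : ∀ {c cs a b} → Star (AdjacentIn (_∈ cs)) a b →
           Star (AdjacentIn (_∈ c ∷ cs)) a b
  weaken = gmap (λ a → a) (λ (p , q , r) → there p , there q , r)

  paths : ∀ {cs a b} → Connected cs → a ∈ cs → b ∈ cs → Star (AdjacentIn (_∈ cs)) a b
  paths [ _ ]    (here refl) (here refl) = ε
  paths (_ ∷ _)  (here refl) (here refl) = ε
  paths (_ ∷ cn) (there p)   (there q)   = weaken (paths cn p q)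
  paths (adj ∷ cn) (here refl) (there q) =
    let (_ , m , r) = find adj
    in (here refl , there m , r) ◅ weaken (paths cn m q)
  paths (adj ∷ cn) (there p) (here refl) =
    let (_ , m , r) = find adj
    in weaken (paths cn p m) ◅◅
       (adjacentIn-sym {P = _∈ _} (here refl , there m , r) ◅ ε)

  inhabited : ∀ {cs} → Connected cs → ∃ (_∈ cs)
  inhabited [ c ]   = c , here refl
  inhabited (_ ∷ _) = _ , here refl

fromList : (cs : List Cell) → Connected cs → Polyomino
fromList cs cn = record
  { cells     = _∈ cs
  ; nonempty  = inhabited cn
  ; connected = paths cn
  }

------------------------------------------------------------------------
-- Particular polyominoes

line : ℕ → List Cell
line = applyDownFrom (λ k → + k , 0ℤ)

private
  line-step : ∀ k → Adjacent (+ suc k , 0ℤ) (+ k , 0ℤ)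
  line-step k = trans (ℕ.+-identityʳ _)
    (trans (cong ∣_∣ (ℤ.m-n≡m⊖n (suc k) k))
      (trans (cong ∣_∣ (ℤ.⊖-≥ (ℕ.n≤1+n k))) (ℕ.m+n∸n≡m 1 k)))

  line-connected : ∀ n → Connected (line (suc n))
  line-connected zero    = [ _ ]
  line-connected (suc n) = here (line-step n) ∷ line-connected n

  above-line : ∀ n → Any (Adjacent (0ℤ , + 1)) (line (suc n))
  above-line zero    = here refl
  above-line (suc n) = there (above-line n)

S : (n : ℕ) .{{_ : NonZero n}} → Polyomino
S n@(suc m) = fromList (line n) (line-connected m)

L : (n : ℕ) .{{_ : NonZero n}} → Polyomino
L n@(suc m) = fromList ((0ℤ , + 1) ∷ line n) (above-line m ∷ line-connected m)

T₂ : Polyomino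
T₂ = fromList ((+ 1 , + 1) ∷ (+ 2 , + 0) ∷ (+ 1 , + 0) ∷ (+ 0 , + 0) ∷ [])
  (there (here refl) ∷ here refl ∷ here refl ∷ [ _ ])

C₂ : Polyomino
C₂ = fromList ((+ 1 , + 1) ∷ (+ 0 , + 1) ∷ (+ 1 , + 0) ∷ (+ 0 , + 0) ∷ [])
  (here refl ∷ there (here refl) ∷ here refl ∷ [ _ ])

Z₂ : Polyomino
Z₂ = fromList ((+ 1 , -[1+ 0 ]) ∷ (+ 0 , + 1) ∷ (+ 1 , + 0) ∷ (+ 0 , + 0) ∷ [])
  (there (here refl) ∷ there (here refl) ∷ here refl ∷ [ _ ])

𝒩-size : Fin 5 → ℕ
𝒩-size zero                         = 1
𝒩-size (suc zero)                   = 2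
𝒩-size (suc (suc zero))             = 2
𝒩-size (suc (suc (suc zero)))       = 4
𝒩-size (suc (suc (suc (suc zero)))) = 4

𝒩 : (i : Fin 5) → Vector Polyomino (𝒩-size i)
𝒩 zero                         = L 2 Vector.∷ Vector.[]
𝒩 (suc zero)                   = S 3 Vector.∷ Z₂ Vector.∷ Vector.[]
𝒩 (suc (suc zero))             = S 3 Vector.∷ C₂ Vector.∷ Vector.[]
𝒩 (suc (suc (suc zero)))       = S 4 Vector.∷ L 3 Vector.∷ C₂ Vector.∷ Z₂ Vector.∷ Vector.[]
𝒩 (suc (suc (suc (suc zero)))) = S 4 Vector.∷ T₂ Vector.∷ C₂ Vector.∷ Z₂ Vector.∷ Vector.[]

{-# OPTIONS --safe #-}

-- The breaker plays on a graph of degree at most two on the cells: whenever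
-- the maker marks a cell, she marks its free neighbours in the graph.  So the
-- maker never gets both ends of an edge, and every set of polyominoes all of whose
-- copies contain an edge is a loser.  For each 𝒩 i there is such a graph that is
-- invariant under a sublattice of ℤ², so finitely many checks suffice.
--
-- For the classification, a polyomino is followed cell by cell from a small
-- part: avoiding L₂ confines it to a line, and avoiding S₃ and C₂ confines it to
-- a staircase.  Both are one-dimensional and homogeneous, so any two polyominoes
-- confined to the same one are comparable and a team has at most one of each kind.

module Submission where

open import Defs
open import Axiom.ExcludedMiddle using (ExcludedMiddle)
open import Data.Bool.Base using (Bool; true; false; not)
open import Data.Fin.Base using (Fin)
open import Data.Fin.Patterns using (0F; 1F; 2F; 3F; 4F)
import Data.Fin.Properties as Fin
open import Data.Integer.Base as ℤ using (ℤ; +_; -[1+_]; 0ℤ; ∣_∣)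
import Data.Integer.DivMod as ℤ
import Data.Integer.Properties as ℤ
open import Data.Integer.Solver using (module +-*-Solver)
open import Data.List.Base using (List; []; _∷_; _++_; map; applyDownFrom; concatMap; upTo)
import Data.List.Membership.DecPropositional as DecMembership
open import Data.List.Membership.Propositional using (_∈_; _∉_; find; lose)
open import Data.List.Membership.Propositional.Properties
  using (∈-map⁻; ∈-++⁺ˡ; ∈-++⁺ʳ; ∈-++⁻; ∈-applyDownFrom⁺; ∈-applyDownFrom⁻; ∈-upTo⁺)
open import Data.List.Relation.Unary.All as All using (All; []; _∷_)
open import Data.List.Relation.Unary.All.Properties using (¬Any⇒All¬)
open import Data.List.Relation.Unary.Any as Any using (Any; here; there)
open import Data.Nat.Base as ℕ using (ℕ; zero; suc; NonZero)
import Data.Nat.Properties as ℕ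
open import Data.Product.Base using (∃; ∃-syntax; _×_; _,_; proj₁; proj₂; map₂)
open import Data.Product.Properties using (≡-dec)
open import Data.Sign.Base as Sign using (Sign)
open import Data.Sum.Base using (_⊎_; inj₁; inj₂; [_,_]′)
open import Data.Unit.Base using (⊤)
open import Data.Vec.Functional using (Vector)
open import Function.Base using (_∘_; id)
open import Level using (0ℓ)
open import Relation.Binary.Construct.Closure.ReflexiveTransitive using (Star; ε; _◅_; gmap)
open import Relation.Binary.Definitions using (DecidableEquality; tri<; tri≈; tri>)
open import Relation.Binary.PropositionalEquality
  using (_≡_; _≢_; refl; sym; trans; cong; cong₂; subst; subst₂)
open import Relation.Nullary using (¬_; Dec; yes; no; contradiction)
open import Relation.Nullary.Decidable using (map′; ¬?; _×-dec_; _⊎-dec_; _→-dec_; from-yes)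
open import Relation.Unary using (Pred)
open +-*-Solver using (solve; con; _:=_; _:+_; _:*_; _:-_; :-_)

-- Congruences

infixl 6 _⊕_ _⊖_

_⊕_ _⊖_ : Cell → Cell → Cell
(x , y) ⊕ (x′ , y′) = x ℤ.+ x′ , y ℤ.+ y′
(x , y) ⊖ (x′ , y′) = x ℤ.- x′ , y ℤ.- y′

origin : Cell
origin = 0ℤ , 0ℤ

⊖_ : Cell → Cell
⊖ (x , y) = ℤ.- x , ℤ.- y

infix 4 _≟_

_≟_ : DecidableEquality Cell
_≟_ = ≡-dec ℤ._≟_ ℤ._≟_

open DecMembership _≟_ using (_∈?_)

⊕-⊖-cancel : ∀ a b c → (a ⊕ b) ⊕ (c ⊖ b) ≡ a ⊕ c
⊕-⊖-cancel (a , a′) (b , b′) (c , c′) = cong₂ _,_ (lemma a b c) (lemma a′ b′ c′)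
  where
  lemma : ∀ a b c → (a ℤ.+ b) ℤ.+ (c ℤ.- b) ≡ a ℤ.+ c
  lemma = solve 3 (λ a b c → (a :+ b) :+ (c :- b) := a :+ c) refl

⊖-cancel : ∀ a b → (a ⊕ b) ⊖ b ≡ a
⊖-cancel (a , a′) (b , b′) = cong₂ _,_ (lemma a b) (lemma a′ b′)
  where
  lemma : ∀ a b → (a ℤ.+ b) ℤ.- b ≡ a
  lemma = solve 2 (λ a b → (a :+ b) :- b := a) refl

⊕-⊖-inverse : ∀ a b → (a ⊕ b) ⊕ (⊖ b) ≡ a
⊕-⊖-inverse (a , a′) (b , b′) = cong₂ _,_ (lemma a b) (lemma a′ b′)
  where
  lemma : ∀ a b → (a ℤ.+ b) ℤ.+ (ℤ.- b) ≡ a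
  lemma = solve 2 (λ a b → (a :+ b) :+ (:- b) := a) refl

⊕-identityʳ-unique : ∀ a b → a ≡ a ⊕ b → b ≡ origin
⊕-identityʳ-unique (a , a′) (b , b′) eq =
  cong₂ _,_ (lemma a b (cong proj₁ eq)) (lemma a′ b′ (cong proj₂ eq))
  where
  lemma : ∀ a b → a ≡ a ℤ.+ b → b ≡ 0ℤ
  lemma a b eq = trans (solve 2 (λ a b → b := (a :+ b) :- a) refl a b)
    (trans (cong (λ z → z ℤ.- a) (sym eq)) (ℤ.+-inverseʳ a))

signed-+ : ∀ s x y → signed s (x ℤ.+ y) ≡ signed s x ℤ.+ signed s y
signed-+ Sign.+ x y = refl
signed-+ Sign.- x y = ℤ.neg-distrib-+ x y

signed-* : ∀ s t x → signed s (signed t x) ≡ signed (s Sign.* t) x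
signed-* Sign.+ t      x = refl
signed-* Sign.- Sign.+ x = refl
signed-* Sign.- Sign.- x = ℤ.neg-involutive x

signed-involutive : ∀ s x → signed s (signed s x) ≡ x
signed-involutive Sign.+ x = refl
signed-involutive Sign.- x = ℤ.neg-involutive x

record Orientation : Set where
  constructor ⟨_,_,_⟩
  field
    swapped     : Bool
    sign₁ sign₂ : Sign

turn : Orientation → Cell → Cell
turn ⟨ w , s , t ⟩ c = let (x , y) = swapIf w c in signed s x , signed t y

congruence : Orientation → Cell → Congruence
congruence ⟨ w , s , t ⟩ d = record { swapped = w ; sign₁ = s ; sign₂ = t ; shift = d }

orientation : Congruence → Orientation
orientation g = let open Congruence g in ⟨ swapped , sign₁ , sign₂ ⟩

orientations : List Orientation
orientations =
  ⟨ false , Sign.+ , Sign.+ ⟩ ∷ ⟨ false , Sign.+ , Sign.- ⟩ ∷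
  ⟨ false , Sign.- , Sign.+ ⟩ ∷ ⟨ false , Sign.- , Sign.- ⟩ ∷
  ⟨ true  , Sign.+ , Sign.+ ⟩ ∷ ⟨ true  , Sign.+ , Sign.- ⟩ ∷
  ⟨ true  , Sign.- , Sign.+ ⟩ ∷ ⟨ true  , Sign.- , Sign.- ⟩ ∷ []

∈-orientations : ∀ o → o ∈ orientations
∈-orientations ⟨ false , Sign.+ , Sign.+ ⟩ = here refl
∈-orientations ⟨ false , Sign.+ , Sign.- ⟩ = there (here refl)
∈-orientations ⟨ false , Sign.- , Sign.+ ⟩ = there (there (here refl))
∈-orientations ⟨ false , Sign.- , Sign.- ⟩ = there (there (there (here refl)))
∈-orientations ⟨ true  , Sign.+ , Sign.+ ⟩ = there (there (there (there (here refl))))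
∈-orientations ⟨ true  , Sign.+ , Sign.- ⟩ = there (there (there (there (there (here refl)))))
∈-orientations ⟨ true  , Sign.- , Sign.+ ⟩ = there (there (there (there (there (there (here refl))))))
∈-orientations ⟨ true  , Sign.- , Sign.- ⟩ = there (there (there (there (there (there (there (here refl)))))))

ι : Congruence
ι = congruence ⟨ false , Sign.+ , Sign.+ ⟩ origin

ι-· : ∀ c → ι · c ≡ c
ι-· (x , y) = cong₂ _,_ (ℤ.+-identityˡ x) (ℤ.+-identityˡ y)

infixr 9 _⊙_

_⊙_ : Congruence → Congruence → Congruence
g ⊙ f with Congruence.swapped g | Congruence.swapped f
... | false | w = let open Congruence in
  congruence ⟨ w , sign₁ g Sign.* sign₁ f , sign₂ g Sign.* sign₂ f ⟩ (g · shift f)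
... | true | w = let open Congruence in
  congruence ⟨ not w , sign₁ g Sign.* sign₂ f , sign₂ g Sign.* sign₁ f ⟩ (g · shift f)

⊙-· : ∀ g f c → (g ⊙ f) · c ≡ g · (f · c)
⊙-· record { swapped = v ; sign₁ = s ; sign₂ = t ; shift = d , e }
    record { swapped = w ; sign₁ = s′ ; sign₂ = t′ ; shift = d′ , e′ } (x , y) =
  cases v w
  where
  part : ∀ s s′ d d′ x → d ℤ.+ signed s d′ ℤ.+ signed (s Sign.* s′) x ≡ d ℤ.+ signed s (d′ ℤ.+ signed s′ x)
  part s s′ d d′ x = trans (ℤ.+-assoc d _ _)
    (cong (λ z → d ℤ.+ z) (trans (cong (λ z → signed s d′ ℤ.+ z) (sym (signed-* s s′ x)))
      (sym (signed-+ s d′ (signed s′ x)))))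
  cases : ∀ v w →
    let g = congruence ⟨ v , s , t ⟩ (d , e); f = congruence ⟨ w , s′ , t′ ⟩ (d′ , e′) in
    (g ⊙ f) · (x , y) ≡ g · (f · (x , y))
  cases false false = cong₂ _,_ (part s s′ d d′ x) (part t t′ e e′ y)
  cases false true  = cong₂ _,_ (part s s′ d d′ y) (part t t′ e e′ x)
  cases true  false = cong₂ _,_ (part s t′ d e′ y) (part t s′ e d′ x)
  cases true  true  = cong₂ _,_ (part s t′ d e′ x) (part t s′ e d′ y)

inv : Congruence → Congruence
inv record { swapped = false ; sign₁ = s ; sign₂ = t ; shift = d , e } =
  congruence ⟨ false , s , t ⟩ (ℤ.- signed s d , ℤ.- signed t e)
-- A swap sends each coordinate through the sign and shift of the other one, so undoing it exchanges
-- the two signs and the two shifts.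
inv record { swapped = true ; sign₁ = s ; sign₂ = t ; shift = d , e } =
  congruence ⟨ true , t , s ⟩ (ℤ.- signed t e , ℤ.- signed s d)

inverseˡ : ∀ g c → inv g · (g · c) ≡ c
inverseˡ record { swapped = w ; sign₁ = s ; sign₂ = t ; shift = d , e } (x , y) = cases w
  where
  part : ∀ s d x → ℤ.- signed s d ℤ.+ signed s (d ℤ.+ signed s x) ≡ x
  part s d x rewrite signed-+ s d (signed s x) | signed-involutive s x =
    solve 2 (λ d x → :- d :+ (d :+ x) := x) refl (signed s d) x
  cases : ∀ w → let g = congruence ⟨ w , s , t ⟩ (d , e) in inv g · (g · (x , y)) ≡ (x , y)
  cases false = cong₂ _,_ (part s d x) (part t e y)
  cases true  = cong₂ _,_ (part t e x) (part s d y)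

inverseʳ : ∀ g c → g · (inv g · c) ≡ c
inverseʳ record { swapped = w ; sign₁ = s ; sign₂ = t ; shift = d , e } (x , y) = cases w
  where
  neg : ∀ s x → signed s (ℤ.- x) ≡ ℤ.- signed s x
  neg Sign.+ x = refl
  neg Sign.- x = refl
  part : ∀ s d x → d ℤ.+ signed s (ℤ.- signed s d ℤ.+ signed s x) ≡ x
  part s d x rewrite signed-+ s (ℤ.- signed s d) (signed s x) | neg s (signed s d)
                   | signed-involutive s d | signed-involutive s x =
    solve 2 (λ d x → d :+ (:- d :+ x) := x) refl d x
  cases : ∀ w → let g = congruence ⟨ w , s , t ⟩ (d , e) in g · (inv g · (x , y)) ≡ (x , y)
  cases false = cong₂ _,_ (part s d x) (part t e y)
  cases true  = cong₂ _,_ (part s d x) (part t e y)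

·-adjacent : ∀ g {a b} → Adjacent a b → Adjacent (g · a) (g · b)
·-adjacent record { swapped = w ; sign₁ = s ; sign₂ = t ; shift = d , e } {x , y} {x′ , y′} = cases w
  where
  part : ∀ s d x x′ → ∣ (d ℤ.+ signed s x) ℤ.- (d ℤ.+ signed s x′) ∣ ≡ ∣ x ℤ.- x′ ∣
  part Sign.+ d x x′ = cong ∣_∣ (solve 3 (λ d x x′ → (d :+ x) :- (d :+ x′) := x :- x′) refl d x x′)
  part Sign.- d x x′ = trans
    (cong ∣_∣ (solve 3 (λ d x x′ → (d :+ (:- x)) :- (d :+ (:- x′)) := :- (x :- x′)) refl d x x′))
    (ℤ.∣-i∣≡∣i∣ (x ℤ.- x′))
  cases : ∀ w → let g = congruence ⟨ w , s , t ⟩ (d , e) in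
          Adjacent (x , y) (x′ , y′) → Adjacent (g · (x , y)) (g · (x′ , y′))
  cases false adj = trans (cong₂ ℕ._+_ (part s d x x′) (part t e y y′)) adj
  cases true  adj = trans (cong₂ ℕ._+_ (part s d y y′) (part t e x x′))
                    (trans (ℕ.+-comm ∣ y ℤ.- y′ ∣ ∣ x ℤ.- x′ ∣) adj)

-- Neighbouring cells

units : List Cell
units = (+ 1 , 0ℤ) ∷ (-[1+ 0 ] , 0ℤ) ∷ (0ℤ , + 1) ∷ (0ℤ , -[1+ 0 ]) ∷ []

neighbours : Cell → List Cell
neighbours c = map (c ⊕_) units

adjacent⇒neighbour : ∀ {a b} → Adjacent a b → b ∈ neighbours a
-- Once the two differences are variables, the distance equation leaves four pairs of integers, one
-- for each unit.
adjacent⇒neighbour {x , y} {x′ , y′} = cases refl refl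
  where
  recover : ∀ x {x′ d} → x ℤ.- x′ ≡ d → x′ ≡ x ℤ.+ ℤ.- d
  recover x {x′} refl = solve 2 (λ x x′ → x′ := x :+ :- (x :- x′)) refl x x′

  cases : ∀ {d e} → x ℤ.- x′ ≡ d → y ℤ.- y′ ≡ e → ∣ d ∣ ℕ.+ ∣ e ∣ ≡ 1 →
          (x′ , y′) ∈ neighbours (x , y)
  cases { -[1+ 0 ]} {+ 0} p q _ = here (cong₂ _,_ (recover x p) (recover y q))
  cases {+ 1} {+ 0} p q _ = there (here (cong₂ _,_ (recover x p) (recover y q)))
  cases {+ 0} { -[1+ 0 ]} p q _ = there (there (here (cong₂ _,_ (recover x p) (recover y q))))
  cases {+ 0} {+ 1} p q _ = there (there (there (here (cong₂ _,_ (recover x p) (recover y q)))))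

infix 4 _↪_

-- Taken between predicates, so that cell lists and whole tracks can be compared as well. On the
-- cells of two polyominoes it unfolds to `⊑`.
_↪_ : Pred Cell 0ℓ → Pred Cell 0ℓ → Set
A ↪ B = ∃[ g ] (∀ {c} → A c → B (g · c))

↪-trans : ∀ {A B C} → A ↪ B → B ↪ C → A ↪ C
↪-trans {C = C} (f , p) (g , q) = g ⊙ f , λ {c} a → subst C (sym (⊙-· g f c)) (q (p a))

⊆⇒↪ : ∀ {A B : Pred Cell 0ℓ} → (∀ {c} → A c → B c) → A ↪ B
⊆⇒↪ {B = B} f = ι , λ {c} a → subst B (sym (ι-· c)) (f a)

-- Confinement

-- A congruence embedding a list is determined by its orientation and the
-- image of the head.
embeds? : (cs ds : List Cell) → Dec ((_∈ cs) ↪ (_∈ ds))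
embeds? []          ds = yes (ι , λ ())
embeds? cs@(c₀ ∷ _) ds = map′ sound complete
  (Any.any? (λ o → Any.any? (λ d → All.all? (λ c → (congruence o (d ⊖ turn o c₀) · c) ∈? ds) cs) ds)
    orientations)
  where
  Maps : Orientation → Cell → Set
  Maps o d = All (λ c → (congruence o (d ⊖ turn o c₀) · c) ∈ ds) cs

  sound : Any (λ o → Any (Maps o) ds) orientations → (_∈ cs) ↪ (_∈ ds)
  sound p = let (o , _ , q) = find p; (d , _ , r) = find q in
            congruence o (d ⊖ turn o c₀) , All.lookup r

  complete : (_∈ cs) ↪ (_∈ ds) → Any (λ o → Any (Maps o) ds) orientations
  complete (g , f) = lose (∈-orientations (orientation g)) (lose (f (here refl)) (All.tabulate λ {c} m →
    subst (λ t → congruence (orientation g) t · c ∈ ds)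
      (sym (⊖-cancel (Congruence.shift g) (turn (orientation g) c₀))) (f m)))

-- Outcomes of enlarging a copy of B inside a polyomino by the cell e: the
-- result has a forbidden part, or e already belongs to a copy of B moved
-- by one of the steps.
Step : List Congruence → List (List Cell) → List Cell → Cell → Set
Step steps Fs B e = e ∈ B
  ⊎ Any (λ F → (_∈ F) ↪ (_∈ e ∷ B)) Fs
  ⊎ Any (λ g → All (λ b → g · b ∈ e ∷ B) B × e ∈ map (g ·_) B) steps

Closed : List Congruence → List (List Cell) → List Cell → Set
Closed steps Fs B = All (λ b → All (Step steps Fs B) (neighbours b)) B

closed? : ∀ steps Fs B → Dec (Closed steps Fs B)
closed? steps Fs B = All.all? (λ b → All.all? (λ e → e ∈? B
  ⊎-dec Any.any? (λ F → embeds? F (e ∷ B)) Fs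
  ⊎-dec Any.any? (λ g → All.all? (λ b → (g · b) ∈? (e ∷ B)) B ×-dec e ∈? map (g ·_) B) steps)
  (neighbours b)) B

module _ {steps Fs B} (closed : Closed steps Fs B) (on : Pred Cell 0ℓ)
         (B⊆on : ∀ {c} → c ∈ B → on c)
         (preserved : All (λ g → ∀ {c} → on c → on (g · c)) steps)
         (P : Polyomino) (avoids : All (λ F → ¬ (_∈ F) ↪ cells P) Fs) where

  private
    module Walk (g : Congruence) where

      -- The invariant of the walk: the current cell lies in a copy of `B` inside `P`, and in the
      -- frame of `g` this copy arises from `B` by a congruence that preserves the track.
      record At (c : Cell) : Set where
        constructor at
        field
          move   : Congruence
          stable : ∀ {a} → on a → on (move · a)
          inside : ∀ {b} → b ∈ B → cells P (g · (move · b))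
          {base} : Cell
          base∈  : base ∈ B
          here≡  : c ≡ g · (move · base)

      step : ∀ {c e} → At c → AdjacentIn (cells P) c e → At e
      step {e = e} (at h st ins {b} b∈ refl) (_ , e∈P , adj) =
        -- Pulled back along `g` and `h`, the new cell is a neighbour of a cell of `B`, so one of
        -- the three outcomes of `Step` applies to it.
        go (All.lookup (All.lookup closed b∈) (adjacent⇒neighbour {b} adj′))
        where
        e′ = inv h · (inv g · e)

        back : g · (h · e′) ≡ e
        back = trans (cong (g ·_) (inverseʳ h (inv g · e))) (inverseʳ g e)

        adj′ : Adjacent b e′
        adj′ = subst (λ z → Adjacent z e′) (inverseˡ h b)
          (·-adjacent (inv h) {h · b} (subst (λ z → Adjacent z (inv g · e)) (inverseˡ g (h · b))
            (·-adjacent (inv g) {g · (h · b)} {e} adj)))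

        ins′ : ∀ {c} → c ∈ e′ ∷ B → cells P (g · (h · c))
        ins′ (here refl) = subst (cells P) (sym back) e∈P
        ins′ (there m)   = ins m

        go : Step steps Fs B e′ → At e
        go (inj₁ m) = at h st ins m (sym back)
        go (inj₂ (inj₁ m)) = let (_ , F∈ , F↪) = find m in
          contradiction (↪-trans {C = cells P} F↪ (g ⊙ h , λ {c} m → subst (cells P) (sym (⊙-· g h c)) (ins′ m)))
            (All.lookup avoids F∈)
        go (inj₂ (inj₂ m)) =
          let (k , k∈ , kB⊆ , e∈) = find m
              (b′ , b′∈ , e≡)     = ∈-map⁻ (k ·_) e∈ in
          at (h ⊙ k)
             (λ {a} p → subst on (sym (⊙-· h k a)) (st (All.lookup preserved k∈ p)))
             (λ {b} m → subst (λ z → cells P (g · z)) (sym (⊙-· h k b)) (ins′ (All.lookup kB⊆ m)))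
             b′∈
             (trans (sym back) (cong (g ·_) (trans (cong (h ·_) e≡) (sym (⊙-· h k b′)))))

      walk : ∀ {c e} → At c → Star (AdjacentIn (cells P)) c e → At e
      walk p ε       = p
      walk p (a ◅ w) = walk (step p a) w

  -- Walk from one cell of the copy of `B` to any cell of `P`. The forbidden outcome never occurs,
  -- so the copy of `B` only moves by steps that preserve the track, and undoing `g` puts every cell
  -- reached on the track.
  confined : ∀ {b} → b ∈ B → (_∈ B) ↪ cells P → cells P ↪ on
  confined {b} b∈ (g , f) = inv g , λ {c} c∈P →
    let at h st _ {b′} b′∈ eq = walk start (connected P (f b∈) c∈P) in
    subst on (sym (trans (cong (inv g ·_) eq) (inverseˡ g (h · b′)))) (st (B⊆on b′∈))
    where
    open Walk g
    start : At (g · b)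
    start = at ι (λ {a} → subst on (sym (ι-· a))) (λ {a} m → subst (λ z → cells P (g · z)) (sym (ι-· a)) (f m)) b∈
      (cong (g ·_) (sym (ι-· b)))

-- Tracks

-- A one-dimensional set of cells with the integer coordinate `pos`. By `pos-unit` an adjacent cell
-- is never more than one position ahead, and the three congruences induce generators of the
-- isometry group of ℤ.
record Track : Set₁ where
  field
    on       : Pred Cell 0ℓ
    pos      : Cell → ℤ
    pos-inj  : ∀ {a b} → on a → on b → pos a ≡ pos b → a ≡ b
    pos-⊕    : ∀ c d → pos (c ⊕ d) ≡ pos d ℤ.+ pos c
    pos-unit : All (λ d → pos d ℤ.≤ + 1) units
    next previous flip : Congruence
    next-on      : ∀ {c} → on c → on (next · c)
    next-pos     : ∀ c → pos (next · c) ≡ + 1 ℤ.+ pos c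
    previous-on  : ∀ {c} → on c → on (previous · c)
    previous-pos : ∀ c → pos (previous · c) ≡ -[1+ 0 ] ℤ.+ pos c
    flip-on      : ∀ {c} → on c → on (flip · c)
    flip-pos     : ∀ c → pos (flip · c) ≡ ℤ.- pos c

  steps : List Congruence
  steps = next ∷ previous ∷ []

horizontal : Track
horizontal = record
  { on           = λ (_ , y) → y ≡ 0ℤ
  ; pos          = proj₁
  ; pos-inj      = λ { refl refl refl → refl }
  ; pos-⊕        = λ (x , _) (d , _) → ℤ.+-comm x d
  ; pos-unit     = from-yes (All.all? (λ (d , _) → d ℤ.≤? + 1) units)
  ; next         = congruence ⟨ false , Sign.+ , Sign.+ ⟩ (+ 1 , 0ℤ)
  ; previous     = congruence ⟨ false , Sign.+ , Sign.+ ⟩ (-[1+ 0 ] , 0ℤ)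
  ; flip         = congruence ⟨ false , Sign.- , Sign.+ ⟩ origin
  ; next-on      = λ { refl → refl }
  ; next-pos     = λ _ → refl
  ; previous-on  = λ { refl → refl }
  ; previous-pos = λ _ → refl
  ; flip-on      = λ { refl → refl }
  ; flip-pos     = λ _ → ℤ.+-identityˡ _
  }

private
  double≢1 : ∀ z → z ℤ.+ z ≢ + 1
  double≢1 (+ suc n) eq with ℕ.m+n≡0⇒n≡0 n (ℕ.suc-injective (ℤ.+-injective eq))
  ... | ()
  double≢1 (+ 0) ()
  double≢1 -[1+ _ ] ()

  double-injective : ∀ {x x′} → x ℤ.+ x ≡ x′ ℤ.+ x′ → x ≡ x′
  double-injective {x} {x′} eq = ℤ.*-cancelˡ-≡ (+ 2) x x′ (trans (double x) (trans eq (sym (double x′))))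
    where
    double : ∀ x → + 2 ℤ.* x ≡ x ℤ.+ x
    double = solve 1 (λ x → con (+ 2) :* x := x :+ x) refl

-- The antidiagonals on which `x + y` is 0 or 1 form one zigzag path. The position `x - y` has the
-- parity of `x + y`, so it tells the two apart; `next` and `previous` are glide reflections
-- exchanging them.
staircase : Track
staircase = record
  { on           = on
  ; pos          = λ (x , y) → x ℤ.- y
  ; pos-inj      = λ p q eq → inj p q eq
  ; pos-⊕        = λ (x , y) (d , e) →
      solve 4 (λ x y d e → (x :+ d) :- (y :+ e) := (d :- e) :+ (x :- y)) refl x y d e
  ; pos-unit     = from-yes (All.all? (λ (d , e) → d ℤ.- e ℤ.≤? + 1) units)
  ; next         = congruence ⟨ true , Sign.- , Sign.- ⟩ (+ 1 , 0ℤ)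
  ; previous     = congruence ⟨ true , Sign.- , Sign.- ⟩ (0ℤ , + 1)
  ; flip         = congruence ⟨ true , Sign.+ , Sign.+ ⟩ origin
  ; next-on      = λ { {x , y} → complement
      (solve 2 (λ x y → (con (+ 1) :- y) :+ (con (+ 0) :- x) := con (+ 1) :- (x :+ y)) refl x y) }
  ; next-pos     = λ (x , y) →
      solve 2 (λ x y → (con (+ 1) :- y) :- (con (+ 0) :- x) := con (+ 1) :+ (x :- y)) refl x y
  ; previous-on  = λ { {x , y} → complement
      (solve 2 (λ x y → (con (+ 0) :- y) :+ (con (+ 1) :- x) := con (+ 1) :- (x :+ y)) refl x y) }
  ; previous-pos = λ (x , y) →
      solve 2 (λ x y → (con (+ 0) :- y) :- (con (+ 1) :- x) := con -[1+ 0 ] :+ (x :- y)) refl x y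
  ; flip-on      = λ { {x , y} → subst (λ s → s ≡ 0ℤ ⊎ s ≡ + 1)
      (solve 2 (λ x y → x :+ y := (con (+ 0) :+ y) :+ (con (+ 0) :+ x)) refl x y) }
  ; flip-pos     = λ (x , y) →
      solve 2 (λ x y → (con (+ 0) :+ y) :- (con (+ 0) :+ x) := :- (x :- y)) refl x y
  }
  where
  sum : Cell → ℤ
  sum (x , y) = x ℤ.+ y

  on : Cell → Set
  on c = sum c ≡ 0ℤ ⊎ sum c ≡ + 1

  complement : ∀ {s t} → t ≡ + 1 ℤ.- s → s ≡ 0ℤ ⊎ s ≡ + 1 → t ≡ 0ℤ ⊎ t ≡ + 1
  complement t≡ (inj₁ refl) = inj₂ t≡
  complement t≡ (inj₂ refl) = inj₁ t≡

  same : ∀ x y x′ y′ → x ℤ.+ y ≡ x′ ℤ.+ y′ → x ℤ.- y ≡ x′ ℤ.- y′ → (x , y) ≡ (x′ , y′)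
  same x y x′ y′ p q = cong₂ _,_
    (double-injective (trans (plus x y) (trans (cong₂ ℤ._+_ p q) (sym (plus x′ y′)))))
    (double-injective (trans (minus x y) (trans (cong₂ ℤ._-_ p q) (sym (minus x′ y′)))))
    where
    plus : ∀ x y → x ℤ.+ x ≡ (x ℤ.+ y) ℤ.+ (x ℤ.- y)
    plus = solve 2 (λ x y → x :+ x := (x :+ y) :+ (x :- y)) refl
    minus : ∀ x y → y ℤ.+ y ≡ (x ℤ.+ y) ℤ.- (x ℤ.- y)
    minus = solve 2 (λ x y → y :+ y := (x :+ y) :- (x :- y)) refl

  different : ∀ x y x′ y′ → x ℤ.+ y ≡ 0ℤ → x′ ℤ.+ y′ ≡ + 1 → x ℤ.- y ≢ x′ ℤ.- y′
  -- Parity: equal positions would make twice `x′ - x` equal to 1.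
  different x y x′ y′ p q eq = double≢1 (x′ ℤ.- x)
    (trans (solve 4 (λ x y x′ y′ → (x′ :- x) :+ (x′ :- x) := (x′ :+ y′) :- (x :+ y) :+ ((x′ :- y′) :- (x :- y))) refl x y x′ y′)
    (trans (cong₂ (λ s t → s ℤ.- t ℤ.+ ((x′ ℤ.- y′) ℤ.- (x ℤ.- y))) q p)
    (cong (λ t → + 1 ℤ.+ t) (trans (cong (λ t → (x′ ℤ.- y′) ℤ.- t) eq) (ℤ.+-inverseʳ (x′ ℤ.- y′))))))

  inj : ∀ {a b} → on a → on b → proj₁ a ℤ.- proj₂ a ≡ proj₁ b ℤ.- proj₂ b → a ≡ b
  inj {x , y} {x′ , y′} (inj₁ p) (inj₁ q) eq = same x y x′ y′ (trans p (sym q)) eq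
  inj {x , y} {x′ , y′} (inj₂ p) (inj₂ q) eq = same x y x′ y′ (trans p (sym q)) eq
  inj {x , y} {x′ , y′} (inj₁ p) (inj₂ q) eq = contradiction eq (different x y x′ y′ p q)
  inj {x , y} {x′ , y′} (inj₂ p) (inj₁ q) eq = contradiction (sym eq) (different x′ y′ x y q p)

-- Comparing polyominoes confined to one track

transport : Congruence → Polyomino → Polyomino
transport g P = record
  { cells     = λ c → cells P (inv g · c)
  ; nonempty  = let (c , m) = nonempty P in g · c , subst (cells P) (sym (inverseˡ g c)) m
  ; connected = λ {a} {b} p q → subst₂ (Star _) (inverseʳ g a) (inverseʳ g b)
      (gmap (g ·_) (λ {c} {d} (m , n , adj) → subst (cells P) (sym (inverseˡ g c)) m
                                    , subst (cells P) (sym (inverseˡ g d)) n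
                                    , ·-adjacent g {c} {d} adj) (connected P p q))
  }

transport-↪ : ∀ g P → cells (transport g P) ↪ cells P
transport-↪ g P = inv g , id

↪-transport : ∀ g P → cells P ↪ cells (transport g P)
↪-transport g P = g , λ {c} → subst (cells P) (sym (inverseˡ g c))

-- Up to translation and reflection these are all the nonempty intervals of ℤ; `segment n` has
-- `n + 1` points. In this normal position they form a chain under inclusion, which is the source of
-- comparability.
data Shape : Set where
  segment  : ℕ → Shape
  ray full : Shape

_∈ˢ_ : ℤ → Shape → Set
z ∈ˢ segment n = 0ℤ ℤ.≤ z × z ℤ.≤ + n
z ∈ˢ ray       = 0ℤ ℤ.≤ z
z ∈ˢ full      = ⊤

_⊆ˢ_ : Shape → Shape → Set
s ⊆ˢ t = ∀ z → z ∈ˢ s → z ∈ˢ t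

⊆ˢ-total : ∀ s t → s ⊆ˢ t ⊎ t ⊆ˢ s
⊆ˢ-total s           full        = inj₁ _
⊆ˢ-total full        t           = inj₂ _
⊆ˢ-total ray         ray         = inj₁ λ _ → id
⊆ˢ-total (segment _) ray         = inj₁ λ _ → proj₁
⊆ˢ-total ray         (segment _) = inj₂ λ _ → proj₁
⊆ˢ-total (segment m) (segment n) = [ inj₁ ∘ widen , inj₂ ∘ widen ]′ (ℕ.≤-total m n)
  where
  widen : ∀ {m n} → m ℕ.≤ n → segment m ⊆ˢ segment n
  widen m≤n _ (p , q) = p , ℤ.≤-trans q (ℤ.+≤+ m≤n)

private
  0≤-i+j : ∀ {i j} → i ℤ.≤ j → 0ℤ ℤ.≤ ℤ.- i ℤ.+ j
  0≤-i+j {i} {j} i≤j = subst (0ℤ ℤ.≤_) (ℤ.+-comm j (ℤ.- i)) (ℤ.i≤j⇒0≤j-i i≤j)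

  i≤i+j : ∀ {i j} → 0ℤ ℤ.≤ j → i ℤ.≤ i ℤ.+ j
  i≤i+j {i} {j} 0≤j = subst (ℤ._≤ i ℤ.+ j) (ℤ.+-identityʳ i) (ℤ.+-monoʳ-≤ i 0≤j)

module Comparison (em : ExcludedMiddle 0ℓ) (track : Track) where
  open Track track

  -- A congruence preserving the track, tied to the map `f` it induces on positions; this reduces
  -- the classification to intervals of ℤ.
  record Motion (f : ℤ → ℤ) : Set where
    constructor motion
    field
      by    : Congruence
      moves : ∀ {c} → on c → on (by · c) × pos (by · c) ≡ f (pos c)

  infixr 9 _⊚_
  _⊚_ : ∀ {e f} → Motion e → Motion f → Motion (e ∘ f)
  _⊚_ {e} (motion g p) (motion h q) = motion (g ⊙ h) λ {c} m →
    let (m₁ , eq₁) = q m; (m₂ , eq₂) = p m₁ in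
    subst on (sym (⊙-· g h c)) m₂ , trans (cong pos (⊙-· g h c)) (trans eq₂ (cong e eq₁))

  stay : Motion id
  stay = motion ι λ {c} m → subst on (sym (ι-· c)) m , cong pos (ι-· c)

  adjust : ∀ {e f} → (∀ z → e z ≡ f z) → Motion e → Motion f
  adjust e≡f (motion g p) = motion g λ m → map₂ (λ eq → trans eq (e≡f _)) (p m)

  forward : Motion ℤ.suc
  forward = motion next λ {c} m → next-on m , next-pos c

  backward : Motion ℤ.pred
  backward = motion previous λ {c} m → previous-on m , previous-pos c

  mirror : Motion (λ z → ℤ.- z)
  mirror = motion flip λ {c} m → flip-on m , flip-pos c

  translation : ∀ k → Motion (λ z → k ℤ.+ z)
  translation (+ 0)          = adjust (λ z → sym (ℤ.+-identityˡ z)) stay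
  translation (+ suc n)      = adjust (λ z → sym (ℤ.+-assoc (+ 1) (+ n) z)) (forward ⊚ translation (+ n))
  translation -[1+ 0 ]       = backward
  translation -[1+ suc n ]   = adjust (λ z → sym (ℤ.+-assoc -[1+ 0 ] -[1+ n ] z)) (backward ⊚ translation -[1+ n ])

  Piece : Shape → Pred Cell 0ℓ
  Piece s c = on c × pos c ∈ˢ s

  pos-adjacent : ∀ {a b} → Adjacent a b → pos b ℤ.≤ ℤ.suc (pos a)
  pos-adjacent {a} {b} adj with ∈-map⁻ (a ⊕_) (adjacent⇒neighbour {a} {b} adj)
  ... | d , d∈ , refl = ℤ.≤-trans (ℤ.≤-reflexive (pos-⊕ a d)) (ℤ.+-monoˡ-≤ (pos a) (All.lookup pos-unit d∈))

  module _ (P : Polyomino) where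

    -- A discrete intermediate value theorem: the position rises by at most one at each step of the
    -- path, so it cannot jump over `z`.
    between : ∀ {a b} → Star (AdjacentIn (cells P)) a b → cells P a →
              ∀ {z} → pos a ℤ.≤ z → z ℤ.≤ pos b → ∃[ c ] cells P c × pos c ≡ z
    between {a} ε m lo hi = a , m , ℤ.≤-antisym lo hi
    between {a} (_◅_ {j = b} (_ , n , adj) w) m {z} lo hi with pos a ℤ.≟ z
    ... | yes eq = a , m , eq
    ... | no neq = between w n (ℤ.≤-trans (pos-adjacent {a} {b} adj) (ℤ.i<j⇒suc[i]≤j (ℤ.≤∧≢⇒< lo neq))) hi

    -- If no cell attains a maximum, every cell is exceeded by another one. Values are integers, so
    -- each such step gains at least one and repeating it passes any bound.
    extremum : (f : Cell → ℤ) → (∃[ b ] cells P b × (∀ {c} → cells P c → f c ℤ.≤ f b))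
                              ⊎ (∀ z → ∃[ c ] cells P c × z ℤ.≤ f c)
    extremum f with em {∃[ b ] cells P b × (∀ {c} → cells P c → f c ℤ.≤ f b)}
    ... | yes max  = inj₁ max
    ... | no ¬max = inj₂ λ z → let (c , m , p) = climb ∣ z ℤ.- f c₀ ∣ in c , m , ℤ.≤-trans (bound z) p
      where
      c₀ = proj₁ (nonempty P)

      bound : ∀ z → z ℤ.≤ + ∣ z ℤ.- f c₀ ∣ ℤ.+ f c₀
      bound z = ℤ.≤-trans (ℤ.≤-reflexive (solve 2 (λ z w → z := (z :- w) :+ w) refl z (f c₀)))
                          (ℤ.+-monoˡ-≤ (f c₀) (i≤∣i∣ (z ℤ.- f c₀)))
        where
        i≤∣i∣ : ∀ i → i ℤ.≤ + ∣ i ∣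
        i≤∣i∣ (+ _)    = ℤ.≤-refl
        i≤∣i∣ -[1+ _ ] = ℤ.-≤+

      higher : ∀ {b} → cells P b → ∃[ c ] cells P c × f b ℤ.< f c
      higher {b} m with em {∃[ c ] cells P c × f b ℤ.< f c}
      ... | yes p = p
      ... | no ¬p = contradiction (b , m , λ {c} n → ℤ.≮⇒≥ (λ lt → ¬p (c , n , lt))) ¬max

      climb : ∀ k → ∃[ c ] cells P c × + k ℤ.+ f c₀ ℤ.≤ f c
      climb zero    = c₀ , proj₂ (nonempty P) , ℤ.≤-reflexive (ℤ.+-identityˡ (f c₀))
      climb (suc k) = let (c , m , p) = climb k; (d , n , q) = higher m in
        d , n , ℤ.≤-trans (ℤ.≤-reflexive (ℤ.+-assoc (+ 1) (+ k) (f c₀)))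
                          (ℤ.i<j⇒suc[i]≤j (ℤ.≤-<-trans p q))

    module _ (P⊆on : ∀ {c} → cells P c → on c) where

      convex : ∀ {a b c} → cells P a → cells P b → on c → pos a ℤ.≤ pos c → pos c ℤ.≤ pos b → cells P c
      convex p q o lo hi = let (d , m , eq) = between (connected P p q) p lo hi in
        subst (cells P) (pos-inj (P⊆on m) o eq) m

      into : ∀ {f s} → Motion f → (∀ {c} → cells P c → f (pos c) ∈ˢ s) → cells P ↪ Piece s
      into {s = s} (motion g p) h = g , λ m → let (o , eq) = p (P⊆on m) in o , subst (_∈ˢ s) (sym eq) (h m)

      Below Above : ℤ → Set
      Below z = ∃[ a ] cells P a × pos a ℤ.≤ z
      Above z = ∃[ b ] cells P b × z ℤ.≤ pos b

      -- By `convex`, a cell of the track belongs to `P` as soon as `P` has cells on both sides of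
      -- it or at its position.
      onto : ∀ {f s} → Motion f → (∀ {z} → z ∈ˢ s → Below (f z) × Above (f z)) → Piece s ↪ cells P
      onto (motion g p) h = g , λ (o , m) →
        let (o′ , eq) = p o; ((_ , a∈ , lo) , (_ , b∈ , hi)) = h m in
        convex a∈ b∈ o′ (ℤ.≤-trans lo (ℤ.≤-reflexive (sym eq))) (ℤ.≤-trans (ℤ.≤-reflexive eq) hi)

      -- A connected set on the track occupies an interval of positions, and its boundedness above
      -- and below decides the shape. The second use of `extremum`, for the negated position, yields
      -- the minimum.
      classify : ∃[ s ] (cells P ↪ Piece s) × (Piece s ↪ cells P)
      classify with extremum pos | extremum (λ c → ℤ.- pos c)
      ... | inj₁ (t , t∈ , top) | inj₁ (b , b∈ , bottom) = segment ∣ pos t ℤ.- pos b ∣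
        , into (translation (ℤ.- pos b)) (λ {c} m → 0≤-i+j (ℤ.neg-cancel-≤ (bottom m))
            , ℤ.≤-trans (ℤ.+-monoʳ-≤ (ℤ.- pos b) (top m))
                (ℤ.≤-reflexive (trans (ℤ.+-comm (ℤ.- pos b) (pos t)) (sym length≡))))
        , onto (translation (pos b)) (λ (lo , hi) → (b , b∈ , i≤i+j lo)
            , (t , t∈ , ℤ.≤-trans (ℤ.+-monoʳ-≤ (pos b) (ℤ.≤-trans hi (ℤ.≤-reflexive length≡)))
                (ℤ.≤-reflexive (solve 2 (λ b t → b :+ (t :- b) := t) refl (pos b) (pos t)))))
        where
        length≡ : + ∣ pos t ℤ.- pos b ∣ ≡ pos t ℤ.- pos b
        length≡ = ℤ.0≤i⇒+∣i∣≡i (ℤ.i≤j⇒0≤j-i (ℤ.neg-cancel-≤ (bottom t∈)))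
      ... | inj₂ up | inj₁ (b , b∈ , bottom) = ray
        , into (translation (ℤ.- pos b)) (λ m → 0≤-i+j (ℤ.neg-cancel-≤ (bottom m)))
        , onto (translation (pos b)) (λ p → (b , b∈ , i≤i+j p) , up _)
      -- A downward ray is reflected by `z ↦ pos t - z`. This map is its own inverse, so the same
      -- motion serves in both directions.
      ... | inj₁ (t , t∈ , top) | inj₂ down = ray
        , into (translation (pos t) ⊚ mirror) (λ m → ℤ.i≤j⇒0≤j-i (top m))
        , onto (translation (pos t) ⊚ mirror) (λ {z} p →
            (let (c , m , q) = down (ℤ.- (pos t ℤ.- z)) in c , m , ℤ.neg-cancel-≤ q)
          , (t , t∈ , ℤ.≤-trans (ℤ.+-monoʳ-≤ (pos t) (ℤ.neg-mono-≤ p)) (ℤ.≤-reflexive (ℤ.+-identityʳ (pos t)))))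
      ... | inj₂ up | inj₂ down = full , into stay _ , onto stay (λ {z} _ →
          (let (c , m , p) = down (ℤ.- z) in c , m , ℤ.neg-cancel-≤ p) , up z)

  -- Each of the two is mutually embeddable with the piece of its shape, and of two shapes one
  -- includes the other.
  comparable : ∀ P Q → cells P ↪ on → cells Q ↪ on → P ⊑ Q ⊎ Q ⊑ P
  comparable P Q p q =
    let (s , P↪s , s↪P) = classified P p
        (t , Q↪t , t↪Q) = classified Q q
        thread : ∀ P Q {s t} → s ⊆ˢ t → cells P ↪ Piece s → Piece t ↪ cells Q → P ⊑ Q
        thread P Q {s} {t} s⊆t p q = ↪-trans {B = Piece t} {C = cells Q}
          (↪-trans {B = Piece s} {C = Piece t} p (⊆⇒↪ (λ (o , m) → o , s⊆t _ m))) q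
    in [ (λ s⊆t → inj₁ (thread P Q {s} {t} s⊆t P↪s t↪Q))
       , (λ t⊆s → inj₂ (thread Q P {t} {s} t⊆s Q↪t s↪P)) ]′ (⊆ˢ-total s t)
    where
    classified : ∀ P → cells P ↪ on → ∃[ s ] (cells P ↪ Piece s) × (Piece s ↪ cells P)
    classified P (g , f) =
      -- `classify` needs a polyomino lying on the track itself, so `P` is first moved there by `g`.
      let (s , i , j) = classify (transport g P) (λ {c} m → subst on (inverseʳ g c) (f m)) in
      s , ↪-trans {C = Piece s} (↪-transport g P) i , ↪-trans {C = cells P} j (transport-↪ g P)

-- The breaker

fresh : (xs : List Cell) → ∃ (_∉ xs)
fresh xs = (+ suc (reach xs) , 0ℤ) , λ m → ℕ.<⇒≱ (ℕ.n<1+n _) (below m)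
  where
  reach : List Cell → ℕ
  reach []             = 0
  reach ((x , _) ∷ xs) = ∣ x ∣ ℕ.⊔ reach xs

  below : ∀ {x y xs} → (x , y) ∈ xs → ∣ x ∣ ℕ.≤ reach xs
  below (here refl) = ℕ.m≤m⊔n _ _
  below (there m)   = ℕ.≤-trans (below m) (ℕ.m≤n⊔m _ _)

-- The breaker must mark a free cell even when the one she wants is already marked; then any fresh
-- cell will do.
occupy : List Cell → Cell → Cell
occupy xs c with c ∈? xs
... | yes _ = proj₁ (fresh xs)
... | no  _ = c

occupy-free : ∀ xs c → occupy xs c ∉ xs
occupy-free xs c with c ∈? xs
... | yes _ = proj₂ (fresh xs)
... | no c∉ = c∉

occupied : ∀ xs c → c ∈ occupy xs c ∷ xs
occupied xs c with c ∈? xs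
... | yes c∈ = there c∈
... | no  _  = here refl

-- The graph of degree at most two, given by the neighbours of each cell; the two may coincide.
-- Symmetry matters because the maker may take either end of an edge first.
record Paving : Set where
  field
    partners : Cell → Reply

  Paired : Cell → Cell → Set
  Paired c d = let (a , b) = partners c in d ∈ a ∷ b ∷ []

  field
    paired-sym    : ∀ {c d} → Paired c d → Paired d c
    paired-irrefl : ∀ {c} → ¬ Paired c c

  Meets : Pred Cell 0ℓ → Set
  Meets A = ∀ g → ∃[ c ] ∃[ d ] A c × A d × Paired (g · c) (g · d)

  meets-↪ : ∀ {A B} → A ↪ B → Meets A → Meets B
  meets-↪ (f , p) meets g =
    let (c , d , c∈ , d∈ , paired) = meets (g ⊙ f) in
    f · c , f · d , p c∈ , p d∈ , subst₂ Paired (⊙-· g f c) (⊙-· g f d) paired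

  module Defence (σ : Strategy) where

    makerCells : List Reply → List Cell
    makerCells []      = []
    makerCells (r ∷ h) = σ h ∷ makerCells h

    breakerCells : List Reply → List Cell
    breakerCells = concatMap (λ (a , b) → a ∷ b ∷ [])

    marked : List Reply → List Cell
    marked h = (σ h ∷ makerCells h) ++ breakerCells h

    respond : List Reply → Reply
    respond h = let (p , q) = partners (σ h); a = occupy (marked h) p in
      -- The first cell already counts as marked here, so the two cells of the turn differ.
      a , occupy (a ∷ marked h) q

    -- Each reply depends on all earlier ones, so the recursion builds the whole list; `history≡`
    -- identifies it with the list that `Play` forms from `replies`.
    history : ℕ → List Reply
    history zero    = []
    history (suc n) = respond (history n) ∷ history n

    replies : Replies
    replies n = respond (history n)

    open Play σ replies

    history≡ : ∀ n → applyDownFrom replies n ≡ history n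
    history≡ zero    = refl
    history≡ (suc n) = cong (replies n ∷_) (history≡ n)

    makerMarks≡ : ∀ n → makerMarks n ≡ makerCells (history n)
    makerMarks≡ zero    = refl
    makerMarks≡ (suc n) = cong₂ _∷_ (cong σ (history≡ n)) (makerMarks≡ n)

    marked≡ : ∀ n → marked (history n) ≡ makerMarks (suc n) ++ breakerMarks n
    marked≡ n = sym (cong₂ _++_ (makerMarks≡ (suc n)) (cong breakerCells (history≡ n)))

    legal : BreakerLegal
    legal n = (λ a≡b → b∉ (here (sym a≡b)))
            , free (occupy-free (marked (history n)) _)
            , free (b∉ ∘ there)
      where
      b∉ = occupy-free (proj₁ (replies n) ∷ marked (history n)) (proj₂ (partners (σ (history n))))
      free : ∀ {c} → c ∉ marked (history n) → FreeForBreaker n c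
      free {c} c∉ = (λ m → c∉ (subst (c ∈_) (sym (marked≡ n)) (∈-++⁺ˡ m)))
                  , (λ m → c∉ (subst (c ∈_) (sym (marked≡ n)) (∈-++⁺ʳ (makerMarks (suc n)) m)))

    -- `occupy` leaves its target marked in either case: it was marked before, or the breaker marks
    -- it in this turn.
    partner-marked : ∀ n {d} → Paired (makerCell n) d → d ∈ makerMarks (suc n) ++ breakerMarks (suc n)
    partner-marked n {d} p = answer (subst (λ c → Paired c d) (cong σ (history≡ n)) p)
      where
      h = history n
      a = proj₁ (respond h)
      b = proj₂ (respond h)
      earlier : ∀ {d} → d ∈ marked h → d ∈ makerMarks (suc n) ++ breakerMarks (suc n)
      earlier {d} m with ∈-++⁻ (makerMarks (suc n)) (subst (d ∈_) (marked≡ n) m)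
      ... | inj₁ m′ = ∈-++⁺ˡ m′
      ... | inj₂ m′ = ∈-++⁺ʳ (makerMarks (suc n)) (there (there m′))
      now : ∀ {d} → d ∈ b ∷ a ∷ marked h → d ∈ makerMarks (suc n) ++ breakerMarks (suc n)
      now (here refl)         = ∈-++⁺ʳ (makerMarks (suc n)) (there (here refl))
      now (there (here refl)) = ∈-++⁺ʳ (makerMarks (suc n)) (here refl)
      now (there (there m))   = earlier m
      answer : Paired (σ h) d → d ∈ makerMarks (suc n) ++ breakerMarks (suc n)
      answer (here refl)         = now (there (occupied (marked h) _))
      answer (there (here refl)) = now (occupied (a ∷ marked h) _)

    -- Both partners of the earlier cell are marked by the end of its round, whereas a legal later
    -- cell is still unmarked when chosen.
    unpaired< : MakerLegal → ∀ {m n} → m ℕ.< n → ¬ Paired (makerCell m) (makerCell n)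
    unpaired< legalM {m} {n} m<n p with ∈-++⁻ (makerMarks (suc m)) (partner-marked m p)
    ... | inj₁ q = let (k , k<1+m , eq) = ∈-applyDownFrom⁻ makerCell q in
      proj₁ (legalM n) (subst (_∈ makerMarks n) (sym eq) (∈-applyDownFrom⁺ makerCell (ℕ.<-≤-trans k<1+m m<n)))
    ... | inj₂ q = proj₂ (legalM n) (later m<n q)
      where
      later : ∀ {m n c} → m ℕ.≤ n → c ∈ breakerMarks m → c ∈ breakerMarks n
      later {zero} _ ()
      later {m} {suc n} m≤1+n q with ℕ.m≤n⇒m<n∨m≡n m≤1+n
      ... | inj₁ (ℕ.s≤s m≤n) = there (there (later m≤n q))
      ... | inj₂ refl        = q

    unpaired : MakerLegal → ∀ m n → ¬ Paired (makerCell m) (makerCell n)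
    unpaired legalM m n p with ℕ.<-cmp m n
    ... | tri< m<n _ _ = unpaired< legalM m<n p
    ... | tri≈ _ refl _ = paired-irrefl p
    ... | tri> _ _ n<m = unpaired< legalM n<m (paired-sym p)

  breaker-wins : ∀ {I : Set} (𝒮 : I → Polyomino) → (∀ i → Meets (cells (𝒮 i))) → ¬ MakerWins 𝒮
  breaker-wins 𝒮 meets (σ , win) =
    let open Defence σ
        open Play σ replies
        (legalM , n , i , g , has)   = win replies legal
        (c , d , c∈ , d∈ , paired) = meets i g
        (k , _ , c≡) = ∈-applyDownFrom⁻ makerCell (has c∈)
        (l , _ , d≡) = ∈-applyDownFrom⁻ makerCell (has d∈)
    in unpaired legalM k l (subst₂ Paired c≡ d≡ paired)

-- Periodic patterns and their finite checks

residue-unique : ∀ {m r s} p q → r ℕ.< m → s ℕ.< m →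
                 + r ℤ.+ p ℤ.* + m ≡ + s ℤ.+ q ℤ.* + m → r ≡ s
residue-unique {m} {r} {s} p q r<m s<m eq = small ∣ p ℤ.- q ∣ distance
  where
  difference : + s ℤ.- + r ≡ (p ℤ.- q) ℤ.* + m
  difference = trans
    (solve 4 (λ r s P Q → s :- r := (s :+ Q) :- (r :+ P) :+ (P :- Q)) refl (+ r) (+ s) (p ℤ.* + m) (q ℤ.* + m))
    (trans (cong (λ z → (+ s ℤ.+ q ℤ.* + m) ℤ.- z ℤ.+ (p ℤ.* + m ℤ.- q ℤ.* + m)) eq)
    (solve 4 (λ s p q m → (s :+ q :* m) :- (s :+ q :* m) :+ (p :* m :- q :* m) := (p :- q) :* m) refl (+ s) p q (+ m)))

  distance : ∣ s ℤ.⊖ r ∣ ≡ ∣ p ℤ.- q ∣ ℕ.* m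
  distance = trans (cong ∣_∣ (trans (sym (ℤ.m-n≡m⊖n s r)) difference)) (ℤ.abs-* (p ℤ.- q) (+ m))

  small : ∀ k → ∣ s ℤ.⊖ r ∣ ≡ k ℕ.* m → r ≡ s
  small zero    d≡0 = sym (ℤ.+-injective (ℤ.i-j≡0⇒i≡j (+ s) (+ r)
    (trans (ℤ.m-n≡m⊖n s r) (ℤ.∣i∣≡0⇒i≡0 d≡0))))
  -- A nonzero multiple of `m` is at least `m` in absolute value, but two residues differ by less
  -- than `m`.
  small (suc k) d≡  = contradiction (ℕ.≤-trans (ℕ.m≤m+n m (k ℕ.* m)) (ℕ.≤-reflexive (sym d≡)))
    (ℕ.<⇒≱ (ℕ.≤-<-trans (ℤ.∣m⊝n∣≤m⊔n s r) (ℕ.⊔-lub s<m r<m)))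

-- Both sides are remainders of `i + j` modulo `m`. Hence the colour of a displaced cell depends
-- only on the colour of the original one.
%ℕ-+ : ∀ i j m .{{_ : NonZero m}} → (i ℤ.+ j) ℤ.%ℕ m ≡ (+ (i ℤ.%ℕ m) ℤ.+ j) ℤ.%ℕ m
%ℕ-+ i j m = residue-unique ((i ℤ.+ j) ℤ./ℕ m) (i ℤ./ℕ m ℤ.+ (+ (i ℤ.%ℕ m) ℤ.+ j) ℤ./ℕ m)
  (ℤ.n%ℕd<d (i ℤ.+ j) m) (ℤ.n%ℕd<d (+ (i ℤ.%ℕ m) ℤ.+ j) m)
  (trans (sym (ℤ.a≡a%ℕn+[a/ℕn]*n (i ℤ.+ j) m)) (trans (cong (ℤ._+ j) (ℤ.a≡a%ℕn+[a/ℕn]*n i m))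
  (trans (solve 4 (λ r q j m → (r :+ q :* m) :+ j := (r :+ j) :+ q :* m) refl (+ (i ℤ.%ℕ m)) (i ℤ./ℕ m) j (+ m))
  (trans (cong (ℤ._+ (i ℤ./ℕ m) ℤ.* + m) (ℤ.a≡a%ℕn+[a/ℕn]*n (+ (i ℤ.%ℕ m) ℤ.+ j) m))
  (solve 4 (λ r q q′ m → (r :+ q′ :* m) :+ q :* m := r :+ (q :+ q′) :* m) refl
    (+ ((+ (i ℤ.%ℕ m) ℤ.+ j) ℤ.%ℕ m)) (i ℤ./ℕ m) ((+ (i ℤ.%ℕ m) ℤ.+ j) ℤ./ℕ m) (+ m))))))

-- The cell (x , y) is coloured a x + b y modulo m, and the colour of a cell
-- determines the displacements to its two partners.
record Pattern : Set where
  field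
    a b          : ℤ
    m            : ℕ
    .{{nonZero}} : NonZero m
    table        : ℕ → Reply

  weight : Cell → ℤ
  weight (x , y) = a ℤ.* x ℤ.+ b ℤ.* y

  colour : Cell → ℕ
  colour c = weight c ℤ.%ℕ m

  colourAfter : ℕ → Cell → ℕ
  colourAfter r d = (+ r ℤ.+ weight d) ℤ.%ℕ m

  displacements : ℕ → List Cell
  displacements r = let (d , e) = table r in d ∷ e ∷ []

  colour-⊕ : ∀ c d → colour (c ⊕ d) ≡ colourAfter (colour c) d
  colour-⊕ c@(x , y) d@(x′ , y′) = trans
    (cong (ℤ._%ℕ m) (solve 6 (λ a b x y x′ y′ →
      a :* (x :+ x′) :+ b :* (y :+ y′) := (a :* x :+ b :* y) :+ (a :* x′ :+ b :* y′)) refl a b x y x′ y′))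
    (%ℕ-+ (weight c) (weight d) m)

  -- Irreflexivity and symmetry of the pairing, checked once per colour.
  Valid : Set
  Valid = All (λ r →
    All (λ d → d ≢ origin × ⊖ d ∈ displacements (colourAfter r d)) (displacements r)) (upTo m)

  valid? : Dec Valid
  valid? = All.all? (λ r → All.all? (λ d →
    ¬? (d ≟ origin) ×-dec (⊖ d) ∈? displacements (colourAfter r d)) (displacements r)) (upTo m)

  -- Whether a copy contains an edge depends only on its orientation and the colour `r` of its
  -- shift, so eight times `m` cases cover all copies.
  Hits : List Cell → Set
  Hits cs = All (λ o → All (λ r → Any (λ c → Any (λ d →
    turn o d ⊖ turn o c ∈ displacements (colourAfter r (turn o c))) cs) cs) (upTo m)) orientations

  hits? : ∀ cs → Dec (Hits cs)
  hits? cs = All.all? (λ o → All.all? (λ r → Any.any? (λ c → Any.any? (λ d →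
    (turn o d ⊖ turn o c) ∈? displacements (colourAfter r (turn o c))) cs) cs) (upTo m)) orientations

  colour∈ : ∀ c → colour c ∈ upTo m
  colour∈ c = ∈-upTo⁺ (ℤ.n%ℕd<d (weight c) m)

  partners : Cell → Reply
  partners c = let (d , e) = table (colour c) in c ⊕ d , c ⊕ e

  private
    Paired : Cell → Cell → Set
    Paired c d = let (p , q) = partners c in d ∈ p ∷ q ∷ []

    paired⁻ : ∀ {c d} → Paired c d → ∃[ e ] e ∈ displacements (colour c) × d ≡ c ⊕ e
    paired⁻ (here refl)         = _ , here refl , refl
    paired⁻ (there (here refl)) = _ , there (here refl) , refl

    paired⁺ : ∀ {c d e} → e ∈ displacements (colour c) → d ≡ c ⊕ e → Paired c d
    paired⁺ (here refl)         refl = here refl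
    paired⁺ (there (here refl)) refl = there (here refl)

  paving : Valid → Paving
  paving valid = record
    { partners      = partners
    ; paired-sym    = λ {c} {d} p → let (e , e∈ , eq) = paired⁻ {c} {d} p in subst (λ d → Paired d c) (sym eq)
        (paired⁺ {c ⊕ e} (subst (λ r → ⊖ e ∈ displacements r) (sym (colour-⊕ c e))
                   (proj₂ (All.lookup (All.lookup valid (colour∈ c)) e∈)))
                 (sym (⊕-⊖-inverse c e)))
    ; paired-irrefl = λ {c} p → let (e , e∈ , eq) = paired⁻ {c} {c} p in
        proj₁ (All.lookup (All.lookup valid (colour∈ c)) e∈) (⊕-identityʳ-unique c e eq)
    }

  meets : ∀ valid {cs} → Hits cs → Paving.Meets (paving valid) (_∈ cs)
  meets valid hits g =
    let o = orientation g
        s = Congruence.shift g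
        (c , c∈ , p) = find (All.lookup (All.lookup hits (∈-orientations o)) (colour∈ s))
        (d , d∈ , q) = find p
    in c , d , c∈ , d∈ , paired⁺ {g · c} (subst (λ r → turn o d ⊖ turn o c ∈ displacements r)
         (sym (colour-⊕ s (turn o c))) q) (sym (⊕-⊖-cancel s (turn o c) (turn o d)))

-- The five losing teams

l₂ l₃ t₂ c₂ z₂ : List Cell
l₂ = (0ℤ , + 1) ∷ line 2
l₃ = (0ℤ , + 1) ∷ line 3
t₂ = (+ 1 , + 1) ∷ (+ 2 , + 0) ∷ (+ 1 , + 0) ∷ (+ 0 , + 0) ∷ []
c₂ = (+ 1 , + 1) ∷ (+ 0 , + 1) ∷ (+ 1 , + 0) ∷ (+ 0 , + 0) ∷ []
z₂ = (+ 1 , -[1+ 0 ]) ∷ (+ 0 , + 1) ∷ (+ 1 , + 0) ∷ (+ 0 , + 0) ∷ []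

-- A polyomino carries only a predicate, while the decision procedures run on lists of cells.
cellsOf : ∀ i → Fin (𝒩-size i) → List Cell
cellsOf 0F 0F = l₂
cellsOf 1F 0F = line 3
cellsOf 1F 1F = z₂
cellsOf 2F 0F = line 3
cellsOf 2F 1F = c₂
cellsOf 3F 0F = line 4
cellsOf 3F 1F = l₃
cellsOf 3F 2F = c₂
cellsOf 3F 3F = z₂
cellsOf 4F 0F = line 4
cellsOf 4F 1F = t₂
cellsOf 4F 2F = c₂
cellsOf 4F 3F = z₂

cells-𝒩 : ∀ i k → cells (𝒩 i k) ≡ (_∈ cellsOf i k)
cells-𝒩 0F 0F = refl
cells-𝒩 1F 0F = refl
cells-𝒩 1F 1F = refl
cells-𝒩 2F 0F = refl
cells-𝒩 2F 1F = refl
cells-𝒩 3F 0F = refl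
cells-𝒩 3F 1F = refl
cells-𝒩 3F 2F = refl
cells-𝒩 3F 3F = refl
cells-𝒩 4F 0F = refl
cells-𝒩 4F 1F = refl
cells-𝒩 4F 2F = refl
cells-𝒩 4F 3F = refl

-- Found by computer search.
periodicPattern : Fin 5 → Pattern
periodicPattern = λ
  { 0F → record { a = + 0 ; b = + 0 ; m = 1 ; table = λ _ → east , west }
  ; 1F → record { a = + 1 ; b = + 2 ; m = 4 ; table = λ
      { 0 → north , west ; 1 → east , north ; 2 → west , south ; _ → south , east } }
  ; 2F → record { a = + 1 ; b = + 1 ; m = 2 ; table = λ
      { 0 → east , south ; _ → west , north } }
  ; 3F → record { a = + 1 ; b = + 1 ; m = 3 ; table = λ
      { 0 → southeast , northwest ; 1 → east , north ; _ → west , south } }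
  ; 4F → record { a = + 1 ; b = + 3 ; m = 4 ; table = λ
      { 0 → east , north ; 1 → west , east ; 2 → south , west ; _ → north , south } }
  }
  where
  east west north south southeast northwest : Cell
  east      = + 1 , 0ℤ
  west      = -[1+ 0 ] , 0ℤ
  north     = 0ℤ , + 1
  south     = 0ℤ , -[1+ 0 ]
  southeast = east ⊕ south
  northwest = west ⊕ north

valid : ∀ i → Pattern.Valid (periodicPattern i)
valid = from-yes (Fin.all? λ i → Pattern.valid? (periodicPattern i))

hits : ∀ i k → Pattern.Hits (periodicPattern i) (cellsOf i k)
hits = from-yes (Fin.all? λ i → Fin.all? λ k → Pattern.hits? (periodicPattern i) (cellsOf i k))

-- A polyomino inherits the edge in every copy from an ancestor. If the family is unbounded, the
-- members of `𝒩 i` chosen as ancestors form a bounded restriction, which loses to the same breaker.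
⪯-loses : ∀ i {I} {𝒮 : I → Polyomino} → 𝒩 i ⪯ 𝒮 → Loser 𝒮
⪯-loses i {I} {𝒮} emb = λ
  { (bounded _ wins)   → Paving.breaker-wins pav 𝒮 (λ j → let (k , p) = emb j in meets-↪ p (meets-𝒩 k)) wins
  ; (unbounded _ wins) → Paving.breaker-wins pav (λ j → 𝒩 i (proj₁ (emb j))) (λ j → meets-𝒩 (proj₁ (emb j)))
      (wins (λ j → 𝒩 i (proj₁ (emb j))) (λ j → finite (proj₁ (emb j)) , proj₂ (emb j)))
  }
  where
  pav = Pattern.paving (periodicPattern i) (valid i)
  open Paving pav using (Meets; meets-↪)
  meets-𝒩 : ∀ k → Meets (cells (𝒩 i k))
  meets-𝒩 k = subst Meets (sym (cells-𝒩 i k)) (Pattern.meets (periodicPattern i) (valid i) (hits i k))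
  finite : ∀ k → Finite (𝒩 i k)
  finite k = cellsOf i k , λ {c} → subst (λ A → A c) (cells-𝒩 i k)

𝒩-team : ∀ i → IsTeam (𝒩 i)
𝒩-team i {j} {k} j≢k p = incomparable i j k j≢k (subst₂ _↪_ (cells-𝒩 i j) (cells-𝒩 i k) p)
  where
  incomparable : ∀ i j k → j ≢ k → ¬ (_∈ cellsOf i j) ↪ (_∈ cellsOf i k)
  incomparable = from-yes (Fin.all? λ i → Fin.all? λ j → Fin.all? λ k →
    ¬? (j Fin.≟ k) →-dec ¬? (embeds? (cellsOf i j) (cellsOf i k)))

𝒩-loses : ∀ i → Loser (𝒩 i)
𝒩-loses i = ⪯-loses i (λ k → k , ⊆⇒↪ {B = cells (𝒩 i k)} id)

-- Teams

infix 4 _≼_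

_≼_ : List Cell → Polyomino → Set
cs ≼ P = (_∈ cs) ↪ cells P

through : ∀ P Q {cs} → cells P ↪ (_∈ cs) → cs ≼ Q → P ⊑ Q
through P Q = ↪-trans {C = cells Q}

abstract
  third : (a b : Fin 4) → ∃[ c ] c ≢ a × c ≢ b
  third = from-yes (Fin.all? λ (a : Fin 4) → Fin.all? λ (b : Fin 4) → Fin.any? λ (c : Fin 4) →
    ¬? (c Fin.≟ a) ×-dec ¬? (c Fin.≟ b))

  fourth : (a b c : Fin 4) → a ≢ b → a ≢ c → b ≢ c →
           ∃[ d ] d ≢ a × d ≢ b × d ≢ c × (∀ i → i ≡ a ⊎ i ≡ b ⊎ i ≡ c ⊎ i ≡ d)
  fourth = from-yes (Fin.all? λ (a : Fin 4) → Fin.all? λ (b : Fin 4) → Fin.all? λ (c : Fin 4) →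
    ¬? (a Fin.≟ b) →-dec ¬? (a Fin.≟ c) →-dec ¬? (b Fin.≟ c) →-dec
    Fin.any? λ (d : Fin 4) → ¬? (d Fin.≟ a) ×-dec ¬? (d Fin.≟ b) ×-dec ¬? (d Fin.≟ c) ×-dec
    Fin.all? λ (i : Fin 4) → (i Fin.≟ a) ⊎-dec (i Fin.≟ b) ⊎-dec (i Fin.≟ c) ⊎-dec (i Fin.≟ d))

module Classical (em : ExcludedMiddle 0ℓ) where

  -- With no steps the copy of `B` cannot move, so a polyomino without any part from `Fs` never
  -- leaves it.
  grow : ∀ Fs B → Closed [] Fs B → ∀ P {b} → b ∈ B → B ≼ P →
         cells P ↪ (_∈ B) ⊎ Any (_≼ P) Fs
  grow Fs B closed P b∈B B≼P with Any.any? {P = _≼ P} (λ _ → em) Fs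
  ... | yes any = inj₂ any
  ... | no none = inj₁ (confined closed (_∈ B) id [] P (¬Any⇒All¬ Fs none) b∈B B≼P)

  single : ∀ P → line 1 ≼ P
  single P = let (c , c∈) = nonempty P in
    congruence (orientation ι) c , λ { (here refl) → subst (cells P) (⊕-identityʳ c) c∈ }
    where
    ⊕-identityʳ : ∀ c → c ≡ c ⊕ origin
    ⊕-identityʳ (x , y) = sym (cong₂ _,_ (ℤ.+-identityʳ x) (ℤ.+-identityʳ y))

  abstract
    -- A cell beside a domino creates `l₂`; a cell at its end lets the domino move one place along
    -- the line.
    straight : ∀ P → line 2 ≼ P → ¬ l₂ ≼ P → cells P ↪ Track.on horizontal
    straight P 2≼ l⋠ = confined
      (from-yes (closed? steps (l₂ ∷ []) (line 2))) on
      (λ { (here refl) → refl ; (there (here refl)) → refl })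
      ((λ {c} → next-on {c}) ∷ (λ {c} → previous-on {c}) ∷ []) P (l⋠ ∷ []) (here refl) 2≼
      where open Track horizontal

    -- A cell attached to `l₂` completes three in a row or a square, unless it continues the zigzag
    -- at one of its two ends.
    stairs : ∀ P → l₂ ≼ P → ¬ line 3 ≼ P → ¬ c₂ ≼ P → cells P ↪ Track.on staircase
    stairs P l≼ 3⋠ c⋠ = confined
      (from-yes (closed? steps (line 3 ∷ c₂ ∷ []) l₂)) on
      (λ { (here refl) → inj₂ refl ; (there (here refl)) → inj₂ refl ; (there (there (here refl))) → inj₁ refl })
      ((λ {c} → next-on {c}) ∷ (λ {c} → previous-on {c}) ∷ []) P (3⋠ ∷ c⋠ ∷ []) (here refl) l≼
      where open Track staircase

    grow-1 : ∀ P → cells P ↪ (_∈ line 1) ⊎ Any (_≼ P) (line 2 ∷ [])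
    grow-1 P = grow Fs (line 1) (from-yes (closed? [] Fs (line 1))) P (here refl) (single P)
      where
      Fs : List (List Cell)
      Fs = line 2 ∷ []

    grow-2 : ∀ P → line 2 ≼ P → cells P ↪ (_∈ line 2) ⊎ Any (_≼ P) (line 3 ∷ l₂ ∷ [])
    grow-2 P = grow Fs (line 2) (from-yes (closed? [] Fs (line 2))) P (here refl)
      where
      Fs : List (List Cell)
      Fs = line 3 ∷ l₂ ∷ []

    grow-3 : ∀ P → line 3 ≼ P → cells P ↪ (_∈ line 3) ⊎ Any (_≼ P) (line 4 ∷ l₂ ∷ [])
    grow-3 P = grow Fs (line 3) (from-yes (closed? [] Fs (line 3))) P (here refl)
      where
      Fs : List (List Cell)
      Fs = line 4 ∷ l₂ ∷ []

    -- The listed extensions are all the tetrominoes except the straight one.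
    grow-l : ∀ P → l₂ ≼ P → cells P ↪ (_∈ l₂) ⊎ Any (_≼ P) (c₂ ∷ z₂ ∷ l₃ ∷ t₂ ∷ [])
    grow-l P = grow Fs l₂ (from-yes (closed? [] Fs l₂)) P (here refl)
      where
      Fs : List (List Cell)
      Fs = c₂ ∷ z₂ ∷ l₃ ∷ t₂ ∷ []

    -- Any cell attached to a square prolongs one of its sides to three in a row.
    grow-c : ∀ P → c₂ ≼ P → cells P ↪ (_∈ c₂) ⊎ Any (_≼ P) (line 3 ∷ [])
    grow-c P = grow Fs c₂ (from-yes (closed? [] Fs c₂)) P (here refl)
      where
      Fs : List (List Cell)
      Fs = line 3 ∷ []

  3≼l₃ : ∀ P → l₃ ≼ P → line 3 ≼ P
  3≼l₃ P (g , p) = g , p ∘ there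

  3≼t₂ : ∀ P → t₂ ≼ P → line 3 ≼ P
  3≼t₂ P (g , p) = g , p ∘ there

  -- Classification of the teams of size four

  module Team (𝓕 : Vector Polyomino 4) (team : IsTeam 𝓕) where

    distinct : ∀ {i j cs} → i ≢ j → cells (𝓕 i) ↪ (_∈ cs) → ¬ cs ≼ 𝓕 j
    distinct {i} {j} i≢j small cs≼j = team i≢j (through (𝓕 i) (𝓕 j) small cs≼j)

    exception : ∀ (P : Fin 4 → Set) → ¬ (∀ i → P i) → ∃[ i ] ¬ P i
    exception P = Fin.¬∀⟶∃¬ 4 P (λ _ → em)

    -- A single cell would be an ancestor of every other member.
    has-2 : ∀ i → line 2 ≼ 𝓕 i
    has-2 i with grow-1 (𝓕 i)
    ... | inj₁ small = let (j , j≢i , _) = third i i in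
      contradiction (single (𝓕 j)) (distinct {i} {j} (j≢i ∘ sym) small)
    ... | inj₂ (here p) = p

    module Straight (a : Fin 4) (l⋠a : ¬ l₂ ≼ 𝓕 a) where

      -- Two members without a corner would both lie on a line and hence be comparable.
      bent : ∀ {j} → j ≢ a → l₂ ≼ 𝓕 j
      bent {j} j≢a with em {l₂ ≼ 𝓕 j}
      ... | yes p = p
      ... | no ¬p with Comparison.comparable em horizontal (𝓕 j) (𝓕 a)
                         (straight (𝓕 j) (has-2 j) ¬p) (straight (𝓕 a) (has-2 a) l⋠a)
      ...   | inj₁ j⊑a = contradiction j⊑a (team j≢a)
      ...   | inj₂ a⊑j = contradiction a⊑j (team (j≢a ∘ sym))

      has-3 : line 3 ≼ 𝓕 a
      has-3 with grow-2 (𝓕 a) (has-2 a)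
      ... | inj₁ small = let (j , j≢a , _) = third a a in
        contradiction (has-2 j) (distinct {a} {j} (j≢a ∘ sym) small)
      ... | inj₂ (here p)         = p
      ... | inj₂ (there (here q)) = contradiction q l⋠a

      -- If the member were `l₂` itself, it would be an ancestor of a third member, which also has a
      -- corner.
      tetromino : ∀ {j} → j ≢ a → Any (_≼ 𝓕 j) (c₂ ∷ z₂ ∷ l₃ ∷ t₂ ∷ [])
      tetromino {j} j≢a with grow-l (𝓕 j) (bent j≢a)
      ... | inj₂ p     = p
      ... | inj₁ small = let (k , k≢a , k≢j) = third a j in
        contradiction (bent k≢a) (distinct {j} {k} (k≢j ∘ sym) small)

      one-staircase : ∀ {j k} → j ≢ a → k ≢ a → j ≢ k →
                      ¬ line 3 ≼ 𝓕 j → ¬ c₂ ≼ 𝓕 j → ¬ line 3 ≼ 𝓕 k → ¬ ¬ c₂ ≼ 𝓕 k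
      one-staircase {j} {k} j≢a k≢a j≢k 3⋠j c⋠j 3⋠k c⋠k =
        [ team j≢k , team (j≢k ∘ sym) ]′ (Comparison.comparable em staircase (𝓕 j) (𝓕 k)
          (stairs (𝓕 j) (bent j≢a) 3⋠j c⋠j) (stairs (𝓕 k) (bent k≢a) 3⋠k c⋠k))

      module Square (b : Fin 4) (3⋠b : ¬ line 3 ≼ 𝓕 b) (z⋠b : ¬ z₂ ≼ 𝓕 b) where

        b≢a : b ≢ a
        b≢a refl = 3⋠b has-3

        c≼b : c₂ ≼ 𝓕 b
        c≼b with tetromino b≢a
        ... | here p                         = p
        ... | there (here p)                 = contradiction p z⋠b
        ... | there (there (here p))         = contradiction (3≼l₃ (𝓕 b) p) 3⋠b
        ... | there (there (there (here p))) = contradiction (3≼t₂ (𝓕 b) p) 3⋠b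

        -- Lacking three in a row, `𝓕 b` cannot be larger than its square, so it would be an
        -- ancestor of any member containing one.
        no-square : ∀ {j} → j ≢ b → ¬ c₂ ≼ 𝓕 j
        no-square {j} j≢b c≼j with grow-c (𝓕 b) c≼b
        ... | inj₁ small    = distinct {b} {j} (j≢b ∘ sym) small c≼j
        ... | inj₂ (here p) = 3⋠b p

        module Stairs (d : Fin 4) (3⋠d : ¬ line 3 ≼ 𝓕 d) (c⋠d : ¬ c₂ ≼ 𝓕 d) where

          d≢a : d ≢ a
          d≢a refl = 3⋠d has-3

          d≢b : d ≢ b
          d≢b refl = c⋠d c≼b

          z≼d : z₂ ≼ 𝓕 d
          z≼d with tetromino d≢a
          ... | here p                         = contradiction p c⋠d
          ... | there (here p)                 = p
          ... | there (there (here p))         = contradiction (3≼l₃ (𝓕 d) p) 3⋠d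
          ... | there (there (there (here p))) = contradiction (3≼t₂ (𝓕 d) p) 3⋠d

          has-4 : ∀ {e} → e ≢ a → e ≢ b → e ≢ d → line 4 ≼ 𝓕 a
          has-4 {e} e≢a e≢b e≢d with grow-3 (𝓕 a) has-3
          ... | inj₁ small = contradiction (no-square e≢b) (one-staircase d≢a e≢a (e≢d ∘ sym) 3⋠d c⋠d
            (distinct {a} {e} (e≢a ∘ sym) small))
          ... | inj₂ (here p)         = p
          ... | inj₂ (there (here q)) = contradiction q l⋠a

          last-two : ∃[ i ] 𝒩 i ⪯ 𝓕
          last-two with fourth a b d (b≢a ∘ sym) (d≢a ∘ sym) (d≢b ∘ sym)
          ... | e , e≢a , e≢b , e≢d , cover = conclude (tetromino e≢a)
            where
            4≼a = has-4 e≢a e≢b e≢d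

            index₄ : z₂ ≼ 𝓕 e ⊎ l₃ ≼ 𝓕 e →
                     ∀ j → j ≡ a ⊎ j ≡ b ⊎ j ≡ d ⊎ j ≡ e → ∃[ k ] 𝒩 3F k ⊑ 𝓕 j
            index₄ _        j (inj₁ refl)               = 0F , 4≼a
            index₄ _        j (inj₂ (inj₁ refl))        = 2F , c≼b
            index₄ _        j (inj₂ (inj₂ (inj₁ refl))) = 3F , z≼d
            index₄ (inj₁ p) j (inj₂ (inj₂ (inj₂ refl))) = 3F , p
            index₄ (inj₂ p) j (inj₂ (inj₂ (inj₂ refl))) = 1F , p

            index₅ : t₂ ≼ 𝓕 e →
                     ∀ j → j ≡ a ⊎ j ≡ b ⊎ j ≡ d ⊎ j ≡ e → ∃[ k ] 𝒩 4F k ⊑ 𝓕 j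
            index₅ _ j (inj₁ refl)               = 0F , 4≼a
            index₅ _ j (inj₂ (inj₁ refl))        = 2F , c≼b
            index₅ _ j (inj₂ (inj₂ (inj₁ refl))) = 3F , z≼d
            index₅ p j (inj₂ (inj₂ (inj₂ refl))) = 1F , p

            conclude : Any (_≼ 𝓕 e) (c₂ ∷ z₂ ∷ l₃ ∷ t₂ ∷ []) → ∃[ i ] 𝒩 i ⪯ 𝓕
            conclude (here p)                         = contradiction p (no-square e≢b)
            conclude (there (here p))                 = 3F , λ j → index₄ (inj₁ p) j (cover j)
            conclude (there (there (here p)))         = 3F , λ j → index₄ (inj₂ p) j (cover j)
            conclude (there (there (there (here p)))) = 4F , λ j → index₅ p j (cover j)

    characterized : ∃[ i ] 𝒩 i ⪯ 𝓕
    characterized with Fin.all? (λ i → em {l₂ ≼ 𝓕 i})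
    ... | yes bent = 0F , λ j → 0F , bent j
    ... | no ¬bent = beyond₁ (exception (λ i → l₂ ≼ 𝓕 i) ¬bent)
      where
      beyond₁ : ∃[ a ] ¬ l₂ ≼ 𝓕 a → ∃[ i ] 𝒩 i ⪯ 𝓕
      beyond₁ (a , l⋠a) with Fin.all? (λ i → em {line 3 ≼ 𝓕 i ⊎ z₂ ≼ 𝓕 i})
      ... | yes p = 1F , λ j → [ (0F ,_) , (1F ,_) ]′ (p j)
      ... | no ¬p = beyond₂ (exception (λ i → line 3 ≼ 𝓕 i ⊎ z₂ ≼ 𝓕 i) ¬p)
        where
        open Straight a l⋠a

        beyond₂ : ∃[ b ] ¬ (line 3 ≼ 𝓕 b ⊎ z₂ ≼ 𝓕 b) → ∃[ i ] 𝒩 i ⪯ 𝓕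
        beyond₂ (b , ⋠b) with Fin.all? (λ i → em {line 3 ≼ 𝓕 i ⊎ c₂ ≼ 𝓕 i})
        ... | yes q = 2F , λ j → [ (0F ,_) , (1F ,_) ]′ (q j)
        ... | no ¬q = let (d , ⋠d) = exception (λ i → line 3 ≼ 𝓕 i ⊎ c₂ ≼ 𝓕 i) ¬q in
          Square.Stairs.last-two b (⋠b ∘ inj₁) (⋠b ∘ inj₂) d (⋠d ∘ inj₁) (⋠d ∘ inj₂)

proposition6p6 : ExcludedMiddle 0ℓ →
    (∀ (𝓕 : Vector Polyomino 4) → IsTeam 𝓕 → Loser 𝓕) ×
    (∀ i → IsTeam (𝒩 i) × Loser (𝒩 i)) ×
    (∀ (𝓕 : Vector Polyomino 4) → IsTeam 𝓕 → ∃[ i ] 𝒩 i ⪯ 𝓕)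
proposition6p6 em =
    -- The first claim follows from the third, since losing passes upwards along `⪯` from each
    -- `𝒩 i`.
    (λ 𝓕 team → let (i , 𝒩⪯𝓕) = characterized 𝓕 team in ⪯-loses i 𝒩⪯𝓕)
  , (λ i → (λ {j} {k} → 𝒩-team i {j} {k}) , 𝒩-loses i)
  , characterized
  where
  characterized : (𝓕 : Vector Polyomino 4) → IsTeam 𝓕 → ∃[ i ] 𝒩 i ⪯ 𝓕
  characterized 𝓕 team = Classical.Team.characterized em 𝓕 (λ {i} {j} → team {i} {j})
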